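{- Every simple binary matroid has a unique minimal tropical basis.
   Context: A matroid $M=([n],\mathscr C)$ is given by its circuit set $\mathscr C$. It is simple if every circuit has cardinality greater than $2$, and binary if it is representable over $\mathbb F_2$. Let ${\bf TP}^{n-1}$ be the tropical projective space over the tropical semifield $(\mathbb R\cup\{ -\infty\},\max,+)$. For a circuit $C$, $V(C)$ is the set of points $x\in{\bf TP}^{n-1}$ such that the maximum of $\{x_i : i\in C\}$ is attained at least twice. For $B\subseteq\mathscr C$, set $V(B)=\bigcap_{C\in B}V(C)$. The Bergman fan of $M$ is $V(\mathscr C)$. A subset $B\subseteq\mathscr C$ is a tropical basis if $V(B)=V(\mathscr C)$. A tropical basis is minimal if no proper subset of it is a tropical basis. -}

module Defs where

open import Algebra.Bundles using (CommutativeRing)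
import Algebra.Properties.Monoid.Sum as MonoidSum
open import Data.Bool.Base using (Bool; T)
open import Data.Bool.Properties using (xor-∧-commutativeRing)
open import Data.Empty using (⊥-elim)
open import Data.Fin.Base using (Fin)
open import Data.Fin.Subset using (Subset; ∣_∣; _∪_; _-_; ⊥) renaming (_∈_ to _∈ₛ_; _∉_ to _∉ₛ_; _⊆_ to _⊆ₛ_)
open import Data.Integer.Base as ℤ using (+_; -[1+_])
import Data.Integer.Properties as ℤₚ
open import Data.Nat.Base as ℕ using (ℕ; zero; suc)
open import Data.Nat.Coprimality as Coprimality using (1-coprimeTo)
open import Data.Product using (∃; ∃₂; _×_; _,_; proj₁; proj₂)
open import Data.Rational.Base as ℚ using (ℚ; mkℚ; 0ℚ; 1ℚ; ½)
import Data.Rational.Properties as ℚₚ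
open import Data.Rational.Solver using (module +-*-Solver)
import Data.Rational.Unnormalised.Base as ℚᵘ
import Data.Rational.Unnormalised.Properties as ℚᵘₚ
open import Data.Sum.Base using (_⊎_; inj₁; inj₂; swap; [_,_]′)
open import Data.Vec.Functional using (Vector)
open import Function.Bundles using (_⇔_)
open import Level using (Level; 0ℓ) renaming (suc to lsuc)
open import Relation.Binary.Bundles using (Setoid)
import Relation.Binary.Construct.Add.Infimum.Equality as InfEq
import Relation.Binary.Construct.Add.Infimum.NonStrict as InfOrder
open import Relation.Binary.Core using (Rel)
open import Relation.Binary.Definitions using (tri<; tri≈; tri>)
open import Relation.Binary.PropositionalEquality using (_≡_; _≢_; refl; sym; trans; cong; subst; subst₂)
open import Relation.Nullary using (¬_; yes; no)
open import Relation.Nullary.Decidable using (toSum)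
open import Relation.Nullary.Construct.Add.Infimum using (_₋; ⊥₋; [_])
open import Relation.Unary using (Pred; _⊆_; _⊂_; _≐_)

------------------------------------------------------------------------
-- Real numbers: two-sided Dedekind cuts of ℚ

record ℝ : Set₁ where
  field
    L U         : Pred ℚ 0ℓ
    L-inhabited : ∃ L
    U-inhabited : ∃ U
    L-down      : ∀ {p q} → p ℚ.< q → L q → L p
    U-up        : ∀ {p q} → p ℚ.< q → U p → U q
    L-open      : ∀ {p} → L p → ∃ λ q → p ℚ.< q × L q
    U-open      : ∀ {q} → U q → ∃ λ p → p ℚ.< q × U p
    disjoint    : ∀ {q} → L q → ¬ U q
    located     : ∀ {p q} → p ℚ.< q → L p ⊎ U q

open ℝ

infix 4 _≤ᴿ_ _≈ᴿ_

_≤ᴿ_ : Rel ℝ 0ℓ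
x ≤ᴿ y = L x ⊆ L y

_≈ᴿ_ : Rel ℝ 0ℓ
x ≈ᴿ y = x ≤ᴿ y × y ≤ᴿ x

private
  open +-*-Solver using (solve; con; _:+_; _:*_; _:-_; :-_; _:=_)

  L<U : ∀ x {p q} → L x p → U x q → p ℚ.< q
  L<U x {p} {q} Lp Uq with ℚₚ.<-cmp p q
  ... | tri< p<q _ _  = p<q
  ... | tri≈ _ refl _ = ⊥-elim (disjoint x Lp Uq)
  ... | tri> _ _ q<p  = ⊥-elim (disjoint x (L-down x q<p Lp) Uq)

  0<- : ∀ {p q} → p ℚ.< q → 0ℚ ℚ.< q ℚ.- p
  0<- {p} {q} p<q = subst (ℚ._< q ℚ.- p) (ℚₚ.+-inverseʳ p) (ℚₚ.+-monoˡ-< (ℚ.- p) p<q)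

  <-shift : ∀ p {d} → 0ℚ ℚ.< d → p ℚ.< p ℚ.+ d
  <-shift p {d} 0<d = subst (ℚ._< p ℚ.+ d) (ℚₚ.+-identityʳ p) (ℚₚ.+-monoʳ-< p 0<d)

  fromℕ : ℕ → ℚ
  fromℕ n = mkℚ (+ n) 0 (Coprimality.sym (1-coprimeTo n))

  fromℕ-suc : ∀ n → fromℕ (suc n) ≡ 1ℚ ℚ.+ fromℕ n
  fromℕ-suc n = ℚₚ.toℚᵘ-injective (ℚᵘₚ.≃-trans (ℚᵘ.*≡* eq)
                  (ℚᵘₚ.≃-sym (ℚₚ.toℚᵘ-homo-+ 1ℚ (fromℕ n))))
    where
    eq : + suc n ℤ.* + 1 ≡ (+ 1 ℤ.* + 1 ℤ.+ + n ℤ.* + 1) ℤ.* + 1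
    eq = cong (ℤ._* + 1) (cong (λ z → + 1 ℤ.+ z) (sym (ℤₚ.*-identityʳ (+ n))))

  ≤fromℕ : ∀ p → p ℚ.≤ fromℕ ℤ.∣ ℚ.↥ p ∣
  ≤fromℕ (mkℚ n d _) = ℚ.*≤* (ℤₚ.≤-trans
      (ℤₚ.≤-reflexive (ℤₚ.*-identityʳ n))
      (ℤₚ.≤-trans (i≤∣i∣ n) (∣i∣≤∣i∣*d ℤ.∣ n ∣)))
    where
    import Data.Nat.Properties as ℕₚ
    i≤∣i∣ : ∀ i → i ℤ.≤ + ℤ.∣ i ∣
    i≤∣i∣ (+ _)      = ℤₚ.≤-refl
    i≤∣i∣ (-[1+ _ ]) = ℤ.-≤+
    ∣i∣≤∣i∣*d : ∀ k → + k ℤ.≤ + k ℤ.* + suc d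
    ∣i∣≤∣i∣*d k = subst (+ k ℤ.≤_) (ℤₚ.pos-* k (suc d)) (ℤ.+≤+ (ℕₚ.m≤m*n k (suc d)))

  archimedean : ∀ w δ → 0ℚ ℚ.< δ → ∃ λ N → w ℚ.≤ fromℕ N ℚ.* δ
  archimedean w δ 0<δ = ℤ.∣ ℚ.↥ r ∣ , subst (ℚ._≤ fromℕ ℤ.∣ ℚ.↥ r ∣ ℚ.* δ) eq
      (ℚₚ.*-monoʳ-≤-nonNeg δ {{ℚₚ.pos⇒nonNeg δ}} (≤fromℕ r))
    where
    instance
      δ-pos : ℚ.Positive δ
      δ-pos = ℚ.positive 0<δ
      δ-nonZero : ℚ.NonZero δ
      δ-nonZero = ℚₚ.pos⇒nonZero δ
    r : ℚ
    r = w ℚ.* (ℚ.1/ δ)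
    eq : r ℚ.* δ ≡ w
    eq = trans (ℚₚ.*-assoc w (ℚ.1/ δ) δ)
        (trans (cong (w ℚ.*_) (ℚₚ.*-inverseˡ δ)) (ℚₚ.*-identityʳ w))

  U-up-≤ : ∀ x {p q} → p ℚ.≤ q → U x p → U x q
  U-up-≤ x p≤q Up with U-open x Up
  ... | r , r<p , Ur = U-up x (ℚₚ.<-≤-trans r<p p≤q) Ur

  -- walk upwards from a in steps of δ, at most N times
  walk : ∀ x δ → 0ℚ ℚ.< δ → ∀ N a → L x a → U x (a ℚ.+ fromℕ N ℚ.* δ) →
         ∃ λ b → L x b × U x (b ℚ.+ (δ ℚ.+ δ))
  walk x δ 0<δ zero a La Ua = ⊥-elim (disjoint x La
    (subst (U x) (solve 2 (λ a d → a :+ con 0ℚ :* d := a) refl a δ) Ua))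
  walk x δ 0<δ (suc N) a La Ua
    with located x (<-shift (a ℚ.+ δ) 0<δ)
  ... | inj₂ U₂ = a , La , subst (U x) (ℚₚ.+-assoc a δ δ) U₂
  ... | inj₁ L₁ = walk x δ 0<δ N (a ℚ.+ δ) L₁ (subst (U x) eq Ua)
    where
    eq : a ℚ.+ fromℕ (suc N) ℚ.* δ ≡ (a ℚ.+ δ) ℚ.+ fromℕ N ℚ.* δ
    eq = trans (cong (λ z → a ℚ.+ z ℚ.* δ) (fromℕ-suc N))
      (solve 3 (λ a d n → a :+ (con 1ℚ :+ n) :* d := (a :+ d) :+ n :* d) refl a δ (fromℕ N))

  half : ℚ → ℚ
  half ε = ½ ℚ.* ε

  half+half : ∀ ε → half ε ℚ.+ half ε ≡ ε
  half+half = solve 1 (λ e → con ½ :* e :+ con ½ :* e := e) refl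

  half-pos : ∀ {ε} → 0ℚ ℚ.< ε → 0ℚ ℚ.< half ε
  half-pos {ε} 0<ε = subst (ℚ._< half ε) (ℚₚ.*-zeroʳ ½) (ℚₚ.*-monoʳ-<-pos ½ 0<ε)

  approx : ∀ x ε → 0ℚ ℚ.< ε → ∃ λ a → L x a × U x (a ℚ.+ ε)
  approx x ε 0<ε =
    let a , La = L-inhabited x
        c , Uc = U-inhabited x
        δ      = half ε
        0<δ    = half-pos 0<ε
        N , le = archimedean (c ℚ.- a) δ 0<δ
        c≤     = subst (ℚ._≤ a ℚ.+ fromℕ N ℚ.* δ)
                   (solve 2 (λ a c → a :+ (c :- a) := c) refl a c)
                   (ℚₚ.+-monoʳ-≤ a le)
        b , Lb , Ub = walk x δ 0<δ N a La (U-up-≤ x c≤ Uc)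
    in b , Lb , subst (λ z → U x (b ℚ.+ z)) (half+half ε) Ub

infixl 6 _+ᴿ_

_+ᴿ_ : ℝ → ℝ → ℝ
x +ᴿ y = record
  { L           = λ q → ∃₂ λ a b → L x a × L y b × q ≡ a ℚ.+ b
  ; U           = λ q → ∃₂ λ a b → U x a × U y b × q ≡ a ℚ.+ b
  ; L-inhabited = let a , La = L-inhabited x ; b , Lb = L-inhabited y in _ , a , b , La , Lb , refl
  ; U-inhabited = let a , Ua = U-inhabited x ; b , Ub = U-inhabited y in _ , a , b , Ua , Ub , refl
  ; L-down      = λ {p} p<q (a , b , La , Lb , eq) →
                    p ℚ.- b , b , L-down x (move b p<q eq) La , Lb , split p b
  ; U-up        = λ {p} {q} p<q (a , b , Ua , Ub , eq) →
                    q ℚ.- b , b , U-up x (move′ b p<q eq) Ua , Ub , split q b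
  ; L-open      = λ { (a , b , La , Lb , refl) → let a′ , a<a′ , La′ = L-open x La in
                      a′ ℚ.+ b , ℚₚ.+-monoˡ-< b a<a′ , a′ , b , La′ , Lb , refl }
  ; U-open      = λ { (a , b , Ua , Ub , refl) → let a′ , a′<a , Ua′ = U-open x Ua in
                      a′ ℚ.+ b , ℚₚ.+-monoˡ-< b a′<a , a′ , b , Ua′ , Ub , refl }
  ; disjoint    = λ (a , b , La , Lb , eq) (c , d , Uc , Ud , eq′) →
                    ℚₚ.<-irrefl (trans (sym eq) eq′) (ℚₚ.+-mono-< (L<U x La Uc) (L<U y Lb Ud))
  ; located     = loc
  }
  where
  split : ∀ p b → p ≡ (p ℚ.- b) ℚ.+ b
  split = solve 2 (λ p b → p := (p :- b) :+ b) refl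
  move : ∀ {p q a} b → p ℚ.< q → q ≡ a ℚ.+ b → p ℚ.- b ℚ.< a
  move {p} {a = a} b p<q refl = subst (p ℚ.- b ℚ.<_)
    (solve 2 (λ a b → (a :+ b) :- b := a) refl a b) (ℚₚ.+-monoˡ-< (ℚ.- b) p<q)
  move′ : ∀ {p q a} b → p ℚ.< q → p ≡ a ℚ.+ b → a ℚ.< q ℚ.- b
  move′ {q = q} {a} b p<q refl = subst (ℚ._< q ℚ.- b)
    (solve 2 (λ a b → (a :+ b) :- b := a) refl a b) (ℚₚ.+-monoˡ-< (ℚ.- b) p<q)
  L-down-≤ : ∀ {p q} → p ℚ.≤ q → L x q → L x p
  L-down-≤ p≤q Lq = let r , q<r , Lr = L-open x Lq in L-down x (ℚₚ.≤-<-trans p≤q q<r) Lr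
  move-≤ : ∀ p a b → p ℚ.≤ a ℚ.+ b → p ℚ.- b ℚ.≤ a
  move-≤ p a b p≤ = subst (p ℚ.- b ℚ.≤_)
    (solve 2 (λ a b → (a :+ b) :- b := a) refl a b) (ℚₚ.+-monoˡ-≤ (ℚ.- b) p≤)
  gap : ∀ a b e p q → p ℚ.+ (e ℚ.+ e) ≡ q → a ℚ.+ b ℚ.< p → a ℚ.+ e ℚ.< q ℚ.- (b ℚ.+ e)
  gap a b e p q refl lt = subst₂ ℚ._<_
    (solve 3 (λ a b e → (a :+ b) :+ (e :- b) := a :+ e) refl a b e)
    (solve 3 (λ b e p → p :+ (e :- b) := (p :+ (e :+ e)) :- (b :+ e)) refl b e p)
    (ℚₚ.+-monoˡ-< (e ℚ.- b) lt)
  loc′ : ∀ p q e → p ℚ.+ (e ℚ.+ e) ≡ q →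
         (∃ λ a → L x a × U x (a ℚ.+ e)) → (∃ λ b → L y b × U y (b ℚ.+ e)) →
         (∃₂ λ a b → L x a × L y b × p ≡ a ℚ.+ b) ⊎ (∃₂ λ a b → U x a × U y b × q ≡ a ℚ.+ b)
  loc′ p q e eq (a , La , Ua) (b , Lb , Ub) = [ low , high ]′ (toSum (p ℚₚ.≤? a ℚ.+ b))
    where
    low = λ p≤ → inj₁ (p ℚ.- b , b , L-down-≤ (move-≤ p a b p≤) La , Lb , split p b)
    high = λ p≰ → inj₂ (q ℚ.- (b ℚ.+ e) , b ℚ.+ e ,
                     U-up x (gap a b e p q eq (ℚₚ.≰⇒> p≰)) Ua , Ub , split q (b ℚ.+ e))
  loc : ∀ {p q} → p ℚ.< q →
        (∃₂ λ a b → L x a × L y b × p ≡ a ℚ.+ b) ⊎ (∃₂ λ a b → U x a × U y b × q ≡ a ℚ.+ b)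
  loc {p} {q} p<q = loc′ p q e
    (trans (cong (p ℚ.+_) (half+half (q ℚ.- p))) (solve 2 (λ p q → p :+ (q :- p) := q) refl p q))
    (approx x e 0<e) (approx y e 0<e)
    where
    e = half (q ℚ.- p)
    0<e = half-pos (0<- p<q)

0ᴿ : ℝ
0ᴿ = record
  { L = ℚ._< 0ℚ
  ; U = 0ℚ ℚ.<_
  ; L-inhabited = ℚ.- 1ℚ , ℚₚ.negative⁻¹ (ℚ.- 1ℚ)
  ; U-inhabited = 1ℚ , ℚₚ.positive⁻¹ 1ℚ
  ; L-down = ℚₚ.<-trans
  ; U-up = λ p<q 0<p → ℚₚ.<-trans 0<p p<q
  ; L-open = ℚₚ.<-dense
  ; U-open = λ 0<q → let m , 0<m , m<q = ℚₚ.<-dense 0<q in m , m<q , 0<m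
  ; disjoint = ℚₚ.<-asym
  ; located = loc
  }
  where
  loc : ∀ {p q} → p ℚ.< q → p ℚ.< 0ℚ ⊎ 0ℚ ℚ.< q
  loc {p} p<q with p ℚₚ.<? 0ℚ
  ... | yes p<0 = inj₁ p<0
  ... | no  p≮0 = inj₂ (ℚₚ.≤-<-trans (ℚₚ.≮⇒≥ p≮0) p<q)

private
  neg-neg : ∀ q → ℚ.- (ℚ.- q) ≡ q
  neg-neg = solve 1 (λ q → :- (:- q) := q) refl

-ᴿ_ : ℝ → ℝ
-ᴿ x = record
  { L = λ q → U x (ℚ.- q)
  ; U = λ q → L x (ℚ.- q)
  ; L-inhabited = let q , Uq = U-inhabited x in ℚ.- q , subst (U x) (sym (neg-neg q)) Uq
  ; U-inhabited = let q , Lq = L-inhabited x in ℚ.- q , subst (L x) (sym (neg-neg q)) Lq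
  ; L-down = λ p<q → U-up x (ℚₚ.neg-antimono-< p<q)
  ; U-up = λ p<q → L-down x (ℚₚ.neg-antimono-< p<q)
  ; L-open = λ {p} Up → let r , r<-p , Ur = U-open x Up in
      ℚ.- r , subst (ℚ._< ℚ.- r) (neg-neg p) (ℚₚ.neg-antimono-< r<-p) , subst (U x) (sym (neg-neg r)) Ur
  ; U-open = λ {p} Lp → let r , -p<r , Lr = L-open x Lp in
      ℚ.- r , subst (ℚ.- r ℚ.<_) (neg-neg p) (ℚₚ.neg-antimono-< -p<r) , subst (L x) (sym (neg-neg r)) Lr
  ; disjoint = λ Uq Lq → disjoint x Lq Uq
  ; located = λ p<q → swap (located x (ℚₚ.neg-antimono-< p<q))
  }

≤ᴿ-trans : ∀ {x y z} → x ≤ᴿ y → y ≤ᴿ z → x ≤ᴿ z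
≤ᴿ-trans x≤y y≤z l = y≤z (x≤y l)

≈ᴿ-refl : ∀ {x} → x ≈ᴿ x
≈ᴿ-refl = (λ l → l) , (λ l → l)

≈ᴿ-sym : ∀ {x y} → x ≈ᴿ y → y ≈ᴿ x
≈ᴿ-sym (p , q) = q , p

≈ᴿ-trans : ∀ {x y z} → x ≈ᴿ y → y ≈ᴿ z → x ≈ᴿ z
≈ᴿ-trans (p , q) (r , s) = (λ l → r (p l)) , (λ l → q (s l))

+ᴿ-mono-≤ : ∀ {x x′ y y′} → x ≤ᴿ x′ → y ≤ᴿ y′ → x +ᴿ y ≤ᴿ x′ +ᴿ y′
+ᴿ-mono-≤ f g (a , b , La , Lb , eq) = a , b , f La , g Lb , eq

+ᴿ-cong : ∀ {x x′ y y′} → x ≈ᴿ x′ → y ≈ᴿ y′ → x +ᴿ y ≈ᴿ x′ +ᴿ y′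
+ᴿ-cong {x} {x′} {y} {y′} (f , f′) (g , g′) =
  +ᴿ-mono-≤ {x} {x′} {y} {y′} f g , +ᴿ-mono-≤ {x′} {x} {y′} {y} f′ g′

+ᴿ-assoc : ∀ x y z → (x +ᴿ y) +ᴿ z ≈ᴿ x +ᴿ (y +ᴿ z)
+ᴿ-assoc x y z =
    (λ { (_ , c , (a , b , La , Lb , refl) , Lc , refl) →
         a , _ , La , (b , c , Lb , Lc , refl) , ℚₚ.+-assoc a b c })
  , (λ { (a , _ , La , (b , c , Lb , Lc , refl) , refl) →
         _ , c , (a , b , La , Lb , refl) , Lc , sym (ℚₚ.+-assoc a b c) })

+ᴿ-identityˡ : ∀ x → 0ᴿ +ᴿ x ≈ᴿ x
+ᴿ-identityˡ x =
    (λ { (a , b , a<0 , Lb , refl) →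
         L-down x (subst (a ℚ.+ b ℚ.<_) (ℚₚ.+-identityˡ b) (ℚₚ.+-monoˡ-< b a<0)) Lb })
  , (λ {q} Lq → let r , q<r , Lr = L-open x Lq in
       q ℚ.- r , r , subst (q ℚ.- r ℚ.<_) (ℚₚ.+-inverseʳ r) (ℚₚ.+-monoˡ-< (ℚ.- r) q<r) , Lr
       , solve 2 (λ q r → q := (q :- r) :+ r) refl q r)

-ᴿ-inverseˡ : ∀ x → (-ᴿ x) +ᴿ x ≈ᴿ 0ᴿ
-ᴿ-inverseˡ x =
    (λ { (a , b , Ua , Lb , refl) →
         subst (a ℚ.+ b ℚ.<_) (ℚₚ.+-inverseʳ a) (ℚₚ.+-monoʳ-< a (L<U x Lb Ua)) })
  , (λ {q} q<0 → let a , La , Ua = approx x (ℚ.- q) (ℚₚ.neg-antimono-< q<0) in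
       q ℚ.- a , a
       , subst (U x) (solve 2 (λ a q → a :+ (:- q) := :- (q :- a)) refl a q) Ua
       , La , solve 2 (λ q a → q := (q :- a) :+ a) refl q a)

+ᴿ-cancelˡ : ∀ x y → (-ᴿ x) +ᴿ (x +ᴿ y) ≈ᴿ y
+ᴿ-cancelˡ x y =
  ≈ᴿ-trans {(-ᴿ x) +ᴿ (x +ᴿ y)} {((-ᴿ x) +ᴿ x) +ᴿ y} {y}
    (≈ᴿ-sym {((-ᴿ x) +ᴿ x) +ᴿ y} {(-ᴿ x) +ᴿ (x +ᴿ y)} (+ᴿ-assoc (-ᴿ x) x y))
    (≈ᴿ-trans {((-ᴿ x) +ᴿ x) +ᴿ y} {0ᴿ +ᴿ y} {y}
      (+ᴿ-cong {(-ᴿ x) +ᴿ x} {0ᴿ} {y} {y} (-ᴿ-inverseˡ x) (≈ᴿ-refl {y}))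
      (+ᴿ-identityˡ y))

------------------------------------------------------------------------
-- The tropical semifield ℝ ∪ {-∞} and tropical projective space

𝕋 : Set₁
𝕋 = ℝ ₋

open InfEq _≈ᴿ_ public using () renaming (_≈₋_ to _≈ᵀ_)
open InfOrder _≤ᴿ_ public using () renaming (_≤₋_ to _≤ᵀ_)

infixr 7 _⊙_

-- tropical multiplication by a finite scalar
_⊙_ : ℝ → 𝕋 → 𝕋
c ⊙ ⊥₋    = ⊥₋
c ⊙ [ x ] = [ c +ᴿ x ]

-- Homogeneous coordinates; TP n has n coordinates, so it is TPⁿ⁻¹.
record TP (n : ℕ) : Set₁ where
  field
    coord   : Vector 𝕋 n
    nonzero : ∃ λ i → coord i ≢ ⊥₋

open TP public

infix 4 _∼_

_∼_ : ∀ {n} → Rel (TP n) (lsuc 0ℓ)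
x ∼ y = ∃ λ c → ∀ i → coord y i ≈ᵀ c ⊙ coord x i

private
  ⊙-identity : ∀ t → t ≈ᵀ 0ᴿ ⊙ t
  ⊙-identity ⊥₋    = InfEq.⊥₋≈⊥₋
  ⊙-identity [ x ] = InfEq.[ ≈ᴿ-sym {0ᴿ +ᴿ x} {x} (+ᴿ-identityˡ x) ]

  ⊙-inverse : ∀ c s t → t ≈ᵀ c ⊙ s → s ≈ᵀ (-ᴿ c) ⊙ t
  ⊙-inverse c ⊥₋    ⊥₋    _           = InfEq.⊥₋≈⊥₋
  ⊙-inverse c [ x ] [ y ] InfEq.[ e ] = InfEq.[
    ≈ᴿ-trans {x} {(-ᴿ c) +ᴿ (c +ᴿ x)} {(-ᴿ c) +ᴿ y}
      (≈ᴿ-sym {(-ᴿ c) +ᴿ (c +ᴿ x)} {x} (+ᴿ-cancelˡ c x))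
      (+ᴿ-cong {(-ᴿ c)} {(-ᴿ c)} {c +ᴿ x} {y} (≈ᴿ-refl {(-ᴿ c)}) (≈ᴿ-sym {y} {c +ᴿ x} e)) ]

  ⊙-trans : ∀ c d r s t → s ≈ᵀ c ⊙ r → t ≈ᵀ d ⊙ s → t ≈ᵀ (d +ᴿ c) ⊙ r
  ⊙-trans c d ⊥₋    ⊥₋    ⊥₋    _           _            = InfEq.⊥₋≈⊥₋
  ⊙-trans c d [ x ] [ y ] [ z ] InfEq.[ e ] InfEq.[ e′ ] = InfEq.[
    ≈ᴿ-trans {z} {d +ᴿ y} {(d +ᴿ c) +ᴿ x} e′
      (≈ᴿ-trans {d +ᴿ y} {d +ᴿ (c +ᴿ x)} {(d +ᴿ c) +ᴿ x}
        (+ᴿ-cong {d} {d} {y} {c +ᴿ x} (≈ᴿ-refl {d}) e)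
        (≈ᴿ-sym {(d +ᴿ c) +ᴿ x} {d +ᴿ (c +ᴿ x)} (+ᴿ-assoc d c x))) ]

  ⊙-mono : ∀ c s s′ t t′ → t ≈ᵀ c ⊙ s → t′ ≈ᵀ c ⊙ s′ → s ≤ᵀ s′ → t ≤ᵀ t′
  ⊙-mono c ⊥₋    _      ⊥₋    t′     _           _            _              = InfOrder.⊥₋≤ t′
  ⊙-mono c [ x ] [ x′ ] [ y ] [ y′ ] InfEq.[ e ] InfEq.[ e′ ] InfOrder.[ l ] = InfOrder.[
    ≤ᴿ-trans {y} {c +ᴿ x} {y′} (proj₁ e)
      (≤ᴿ-trans {c +ᴿ x} {c +ᴿ x′} {y′} (+ᴿ-mono-≤ {c} {c} {x} {x′} (λ z → z) l) (proj₂ e′)) ]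

TPSetoid : ℕ → Setoid (lsuc 0ℓ) (lsuc 0ℓ)
TPSetoid n = record
  { Carrier       = TP n
  ; _≈_           = _∼_
  ; isEquivalence = record
    { refl  = λ {x} → 0ᴿ , λ i → ⊙-identity (coord x i)
    ; sym   = λ {x} {y} (c , e) → (-ᴿ c) , λ i → ⊙-inverse c (coord x i) (coord y i) (e i)
    ; trans = λ {x} {y} {z} (c , e) (d , f) → (d +ᴿ c) ,
                λ i → ⊙-trans c d (coord x i) (coord y i) (coord z i) (e i) (f i)
    }
  }

------------------------------------------------------------------------
-- Matroids on [n], given by circuits

Family : ℕ → Set
Family n = Subset n → Bool

⟦_⟧ : ∀ {n} → Family n → Pred (Subset n) 0ℓ
⟦ B ⟧ C = T (B C)

record Matroid (n : ℕ) : Set where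
  field
    circuits     : Family n
    ∅∉           : ¬ ⟦ circuits ⟧ ⊥
    incomparable : ∀ {C D} → ⟦ circuits ⟧ C → ⟦ circuits ⟧ D → C ⊆ₛ D → C ≡ D
    elimination  : ∀ {C D e} → ⟦ circuits ⟧ C → ⟦ circuits ⟧ D → C ≢ D → e ∈ₛ C → e ∈ₛ D →
                   ∃ λ K → ⟦ circuits ⟧ K × K ⊆ₛ ((C ∪ D) - e)

open Matroid public

Simple : ∀ {n} → Matroid n → Set
Simple M = ∀ C → ⟦ circuits M ⟧ C → ∣ C ∣ ℕ.> 2

Independent : ∀ {n} → Matroid n → Pred (Subset n) 0ℓ
Independent M S = ∀ C → ⟦ circuits M ⟧ C → ¬ (C ⊆ₛ S)

module _ {a ℓ : Level} (R : CommutativeRing a ℓ) where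
  open CommutativeRing R
  open MonoidSum +-monoid using (sum)

  -- The columns of A indexed by S, as a family, are linearly independent.
  LinearlyIndependent : ∀ {m n} → (Fin m → Fin n → Carrier) → Subset n → Set _
  LinearlyIndependent {m} {n} A S = (c : Vector Carrier n) → (∀ j → j ∉ₛ S → c j ≈ 0#) →
    (∀ i → sum (λ j → c j * A i j) ≈ 0#) → ∀ j → c j ≈ 0#

  Representable : ∀ {n} → Matroid n → Set _
  Representable {n} M = ∃ λ m → ∃ λ (A : Fin m → Fin n → Carrier) →
    ∀ S → Independent M S ⇔ LinearlyIndependent A S

-- Bool with xor and ∧ is the field 𝔽₂.
Binary : ∀ {n} → Matroid n → Set
Binary = Representable xor-∧-commutativeRing

------------------------------------------------------------------------
-- Bergman fans and tropical bases

AttainsMax : ∀ {n} → Subset n → Vector 𝕋 n → Pred (Fin n) (lsuc 0ℓ)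
AttainsMax C x i = i ∈ₛ C × (∀ k → k ∈ₛ C → x k ≤ᵀ x i)

-- The double negation gives the existential its classical meaning: the order
-- of ℝ is not decidable, so an index attaining a maximum of reals need not be
-- computable.
Vᶜ : ∀ {n} → Subset n → Pred (TP n) (lsuc 0ℓ)
Vᶜ C x = ¬ ¬ (∃₂ λ i j → i ≢ j × AttainsMax C (coord x) i × AttainsMax C (coord x) j)

V : ∀ {n} → Family n → Pred (TP n) (lsuc 0ℓ)
V B x = ∀ C → ⟦ B ⟧ C → Vᶜ C x

-- V B is a subset of the quotient of TP n by _∼_.
V-resp-∼ : ∀ {n} (B : Family n) {x y : TP n} → x ∼ y → V B x → V B y
V-resp-∼ B {x} {y} (c , e) v C C∈B ¬w = v C C∈B
  λ (i , j , i≢j , (i∈C , mi) , (j∈C , mj)) →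
    ¬w (i , j , i≢j , (i∈C , λ k k∈C → transport k i (mi k k∈C))
                    , (j∈C , λ k k∈C → transport k j (mj k k∈C)))
  where
  transport : ∀ k i → coord x k ≤ᵀ coord x i → coord y k ≤ᵀ coord y i
  transport k i = ⊙-mono c (coord x k) (coord x i) (coord y k) (coord y i) (e k) (e i)

BergmanFan : ∀ {n} → Matroid n → Pred (TP n) (lsuc 0ℓ)
BergmanFan M = V (circuits M)

IsTropicalBasis : ∀ {n} → Matroid n → Pred (Family n) (lsuc 0ℓ)
IsTropicalBasis M B = ⟦ B ⟧ ⊆ ⟦ circuits M ⟧ × V B ≐ BergmanFan M

IsMinimalTropicalBasis : ∀ {n} → Matroid n → Pred (Family n) (lsuc 0ℓ)
IsMinimalTropicalBasis {n} M B = IsTropicalBasis M B ×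
  (∀ (B′ : Family n) → ⟦ B′ ⟧ ⊂ ⟦ B ⟧ → ¬ IsTropicalBasis M B′)

{-# OPTIONS --safe #-}

-- The unique minimal tropical basis consists of the chordless circuits, where a
-- chord of C is a circuit D ≠ C with D ⊆ C ∪ {e} for some e.
--
-- They are a tropical basis: if D is a chord of C then, M being binary, the
-- symmetric difference C △ D contains a circuit K.  Then D ∩ K = {e} and
-- C = (D ∪ K) - e, so V(D) ∩ V(K) ⊆ V(C).  Since M is simple, D and K are smaller
-- than C, and induction on ∣ C ∣ applies.
--
-- They lie in every tropical basis: if C is chordless and c ∈ C, let x be -∞ on
-- C - c and 0 elsewhere.  Every circuit other than C has at least two elements
-- outside C, hence attains its maximum 0 twice, whereas C attains it only at c.

module Submission where

open import Defs
import Algebra.Properties.CommutativeMonoid.Sum as CommutativeMonoidSum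
open import Algebra.Bundles using (CommutativeRing)
open import Data.Bool.Base using (Bool; true; false; T; _∧_; _xor_; if_then_else_)
import Data.Bool.Properties as Boolₚ
open import Data.Bool.Properties using (T?; xor-∧-commutativeRing)
open import Data.Empty using (⊥-elim)
open import Data.Fin.Base using (Fin)
open import Data.Fin.Properties using (all?; any?; ¬∀⟶∃¬) renaming (_≟_ to _≟ᶠ_)
open import Data.Fin.Subset using (Subset; inside; outside; ∣_∣; _∪_; _─_; _-_; ⁅_⁆; Nonempty) renaming (_∈_ to _∈ₛ_; _∉_ to _∉ₛ_; _⊆_ to _⊆ₛ_)
open import Data.Fin.Subset.Properties using (_∈?_; _⊆?_; anySubset?; ⊆-antisym; ⊆-refl; Empty-unique; x∈⁅x⁆; x∈⁅y⁆⇒x≡y; ∣⁅x⁆∣≡1; p⊆q⇒∣p∣≤∣q∣; x∈p∪q⁺; x∈p∪q⁻; p─q⊆p; x∈p∧x≢y⇒x∈p-y; x∈p⇒∣p-x∣<∣p∣)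
open import Data.Nat using (ℕ; suc; _+_; _≤_; _<_; _>_; z≤n; s≤s)
open import Data.Nat.Induction using (<-rec)
import Data.Nat.Properties as ℕₚ
open import Data.Product using (∃; ∃₂; ∃!; _×_; _,_; proj₁; proj₂)
import Data.Rational.Properties as ℚₚ
open import Data.Sum.Base using (_⊎_; inj₁; inj₂; [_,_]′; swap) renaming (map to ⊎-map)
open import Data.Vec.Base using ([]; _∷_; lookup; tabulate; zipWith; here; there)
open import Data.Vec.Properties using (lookup⇒[]=; []=⇒lookup; lookup∘tabulate; tabulate∘lookup; tabulate-cong; lookup-zipWith; ≡-dec)
open import Data.Vec.Functional using (Vector)
open import Function.Base using (_∘_; case_of_)
open import Function.Bundles using (Equivalence; _⇔_; mk⇔)
open import Relation.Binary.Construct.Add.Infimum.NonStrict _≤ᴿ_ using (⊥₋≤_; [_]; ≤₋-trans)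
open import Relation.Binary.Definitions using (tri<; tri≈; tri>)
open import Relation.Binary.PropositionalEquality using (_≡_; _≢_; _≗_; refl; sym; trans; cong; cong₂; subst; subst₂)
open import Relation.Nullary using (¬_; Dec; yes; no; contradiction)
open import Relation.Nullary.Construct.Add.Infimum using (⊥₋) renaming ([_] to fin)
open import Relation.Nullary.Decidable using (⌊_⌋; decidable-stable; toWitness; fromWitness; ¬?; _×-dec_; _⊎-dec_; _→-dec_)
open import Relation.Unary using (_⊆_; _⊂_)

private variable
  n : ℕ

-- Subsets

_≟ₛ_ : (p q : Subset n) → Dec (p ≡ q)
_≟ₛ_ = ≡-dec Boolₚ._≟_

⊈⇒∃∉ : (p q : Subset n) → ¬ (p ⊆ₛ q) → ∃ λ i → i ∈ₛ p × i ∉ₛ q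
⊈⇒∃∉ {n} p q p⊈q
  with i , ¬[i∈p→i∈q] ← ¬∀⟶∃¬ n (λ i → i ∈ₛ p → i ∈ₛ q) (λ i → (i ∈? p) →-dec (i ∈? q)) (λ f → p⊈q (f _))
  = i , decidable-stable (i ∈? p) (λ i∉p → ¬[i∈p→i∈q] (⊥-elim ∘ i∉p))
      , λ i∈q → ¬[i∈p→i∈q] (λ _ → i∈q)

∣p∪q∣≤∣p∣+∣q∣ : (p q : Subset n) → ∣ p ∪ q ∣ ≤ ∣ p ∣ + ∣ q ∣
∣p∪q∣≤∣p∣+∣q∣ []            []            = z≤n
∣p∪q∣≤∣p∣+∣q∣ (outside ∷ p) (outside ∷ q) = ∣p∪q∣≤∣p∣+∣q∣ p q
∣p∪q∣≤∣p∣+∣q∣ (inside  ∷ p) (outside ∷ q) = s≤s (∣p∪q∣≤∣p∣+∣q∣ p q)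
∣p∪q∣≤∣p∣+∣q∣ (outside ∷ p) (inside  ∷ q) =
  ℕₚ.≤-trans (s≤s (∣p∪q∣≤∣p∣+∣q∣ p q)) (ℕₚ.≤-reflexive (sym (ℕₚ.+-suc ∣ p ∣ ∣ q ∣)))
∣p∪q∣≤∣p∣+∣q∣ (inside  ∷ p) (inside  ∷ q) =
  s≤s (ℕₚ.≤-trans (∣p∪q∣≤∣p∣+∣q∣ p q) (ℕₚ.+-monoʳ-≤ ∣ p ∣ (ℕₚ.n≤1+n ∣ q ∣)))

∣⁅a⁆∪⁅b⁆∣≤2 : (a b : Fin n) → ∣ ⁅ a ⁆ ∪ ⁅ b ⁆ ∣ ≤ 2
∣⁅a⁆∪⁅b⁆∣≤2 a b = ℕₚ.≤-trans (∣p∪q∣≤∣p∣+∣q∣ ⁅ a ⁆ ⁅ b ⁆)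
  (ℕₚ.≤-reflexive (cong₂ _+_ (∣⁅x⁆∣≡1 a) (∣⁅x⁆∣≡1 b)))

-- The form in which simplicity is used; `a` and `b` may coincide.
avoid₂ : (p : Subset n) → ∣ p ∣ > 2 → ∀ a b → ∃ λ i → i ∈ₛ p × i ≢ a × i ≢ b
avoid₂ p ∣p∣>2 a b
  with i , i∈p , i∉ab ← ⊈⇒∃∉ p (⁅ a ⁆ ∪ ⁅ b ⁆)
         (λ p⊆ab → ℕₚ.<⇒≱ ∣p∣>2 (ℕₚ.≤-trans (p⊆q⇒∣p∣≤∣q∣ p⊆ab) (∣⁅a⁆∪⁅b⁆∣≤2 a b)))
  = i , i∈p
  , (λ { refl → i∉ab (x∈p∪q⁺ (inj₁ (x∈⁅x⁆ i))) })
  , (λ { refl → i∉ab (x∈p∪q⁺ (inj₂ (x∈⁅x⁆ i))) })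

x∈p─q⇒x∉q : (p q : Subset n) → ∀ {x} → x ∈ₛ p ─ q → x ∉ₛ q
x∈p─q⇒x∉q (_ ∷ p) (_ ∷ q) (there x∈) (there x∈q) = x∈p─q⇒x∉q p q x∈ x∈q

x∈p-y⁻ : (p : Subset n) → ∀ {x y} → x ∈ₛ p - y → x ∈ₛ p × x ≢ y
x∈p-y⁻ p {x} {y} x∈ = p─q⊆p p ⁅ y ⁆ x∈ , λ { refl → x∈p─q⇒x∉q p ⁅ x ⁆ x∈ (x∈⁅x⁆ x) }

x∈p∪⁅y⁆∧x≢y⇒x∈p : (p : Subset n) → ∀ {x y} → x ∈ₛ p ∪ ⁅ y ⁆ → x ≢ y → x ∈ₛ p
x∈p∪⁅y⁆∧x≢y⇒x∈p p {x} {y} x∈ x≢y =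
  [ (λ x∈p → x∈p) , (λ x∈y → contradiction (x∈⁅y⁆⇒x≡y y x∈y) x≢y) ]′ (x∈p∪q⁻ p ⁅ y ⁆ x∈)

infixl 6 _△_

_△_ : Subset n → Subset n → Subset n
_△_ = zipWith _xor_

x∈p△q⁻ : (p q : Subset n) → ∀ {x} → x ∈ₛ p △ q → (x ∈ₛ p × x ∉ₛ q) ⊎ (x ∉ₛ p × x ∈ₛ q)
x∈p△q⁻ (inside  ∷ p) (outside ∷ q) here = inj₁ (here , λ ())
x∈p△q⁻ (outside ∷ p) (inside  ∷ q) here = inj₂ ((λ ()) , here)
x∈p△q⁻ (_ ∷ p) (_ ∷ q) (there x∈) = ⊎-map
  (λ (x∈p , x∉q) → there x∈p , λ { (there x∈q) → x∉q x∈q })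
  (λ (x∉p , x∈q) → (λ { (there x∈p) → x∉p x∈p }) , there x∈q)
  (x∈p△q⁻ p q x∈)

lookup-injective : {p q : Subset n} → lookup p ≗ lookup q → p ≡ q
lookup-injective {p = p} {q} p≗q = trans (sym (tabulate∘lookup p)) (trans (tabulate-cong p≗q) (tabulate∘lookup q))

xor≡false⇒≡ : ∀ a b → a xor b ≡ false → a ≡ b
xor≡false⇒≡ true  true  _ = refl
xor≡false⇒≡ false false _ = refl

-- Circuits of binary matroids

-- Refuting independence names no circuit; a finite search over all subsets finds one.
dependent⇒circuit : (M : Matroid n) → ∀ S → ¬ Independent M S → ∃ λ K → ⟦ circuits M ⟧ K × K ⊆ₛ S
dependent⇒circuit M S dep = decidable-stable
  (anySubset? λ K → T? (circuits M K) ×-dec (K ⊆? S))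
  (λ none → dep λ K K∈M K⊆S → none (K , K∈M , K⊆S))

module _ {m n : ℕ} (A : Fin m → Fin n → Bool) where
  open CommutativeMonoidSum (CommutativeRing.+-commutativeMonoid xor-∧-commutativeRing)

  -- The characteristic vector of `S` lies in the kernel of `A`: `S` is an element of the binary
  -- cycle space.
  IsCycle : Subset n → Set
  IsCycle S = ∀ i → sum (λ j → lookup S j ∧ A i j) ≡ false

  isCycle? : ∀ S → Dec (IsCycle S)
  isCycle? S = all? λ i → sum (λ j → lookup S j ∧ A i j) Boolₚ.≟ false

  △-isCycle : ∀ {S T} → IsCycle S → IsCycle T → IsCycle (S △ T)
  △-isCycle {S} {T} kS kT i = trans
    (sum-cong-≗ λ j → trans (cong (_∧ A i j) (lookup-zipWith _xor_ j S T))
                            (Boolₚ.∧-distribʳ-xor (A i j) (lookup S j) (lookup T j)))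
    (trans (∑-distrib-+ (λ j → lookup S j ∧ A i j) (λ j → lookup T j ∧ A i j))
           (cong₂ _xor_ (kS i) (kT i)))

  module _ (M : Matroid n)
           (rep : ∀ S → Independent M S ⇔ LinearlyIndependent xor-∧-commutativeRing A S) where

    -- The characteristic vector of `S` is a nontrivial linear relation supported on `S`.
    cycle⇒circuit : ∀ {S} → IsCycle S → Nonempty S → ∃ λ K → ⟦ circuits M ⟧ K × K ⊆ₛ S
    cycle⇒circuit {S} S-cycle (j , j∈S) = dependent⇒circuit M S λ ind →
      case trans (sym ([]=⇒lookup j∈S))
                 (Equivalence.to (rep S) ind (lookup S) lookup-∉ S-cycle j) of λ ()
      where
      lookup-∉ : ∀ j → j ∉ₛ S → lookup S j ≡ false
      lookup-∉ j j∉S = Boolₚ.¬-not (j∉S ∘ lookup⇒[]= j S)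

    -- Over 𝔽₂ a relation is determined by its support. The support of a nontrivial relation on `C`
    -- is a cycle, so it contains a circuit `K`; incomparability gives `K ≡ C`, so the support is
    -- all of `C`.
    circuit⇒cycle : ∀ {C} → ⟦ circuits M ⟧ C → IsCycle C
    circuit⇒cycle {C} C∈M = decidable-stable (isCycle? C) λ ¬cycle →
      Equivalence.from (rep C) (linearlyIndependent ¬cycle) C C∈M ⊆-refl
      where
      linearlyIndependent : ¬ IsCycle C → LinearlyIndependent xor-∧-commutativeRing A C
      linearlyIndependent ¬cycle c c-supp c-ker j = Boolₚ.¬-not λ cj≡true →
        let K , K∈M , K⊆S = cycle⇒circuit S-cycle (j , lookup⇒[]= j S (trans (lookup∘tabulate c j) cj≡true))
            K≡C = incomparable M K∈M C∈M (λ k∈K → S⊆C (K⊆S k∈K))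
            S≡C = ⊆-antisym S⊆C (subst (_⊆ₛ S) K≡C K⊆S)
        in ¬cycle (subst IsCycle S≡C S-cycle)
        where
        S : Subset n
        S = tabulate c
        S-cycle : IsCycle S
        S-cycle i = trans (sum-cong-≗ λ j → cong (_∧ A i j) (lookup∘tabulate c j)) (c-ker i)
        S⊆C : S ⊆ₛ C
        S⊆C {k} k∈S = decidable-stable (k ∈? C) λ k∉C →
          case trans (sym ([]=⇒lookup k∈S)) (trans (lookup∘tabulate c k) (c-supp k k∉C)) of λ ()

-- Symmetric difference is addition in the cycle space, and the sum is nonempty because `C` and `D`
-- differ.
△-contains-circuit : (M : Matroid n) → Binary M → ∀ {C D} → ⟦ circuits M ⟧ C → ⟦ circuits M ⟧ D →
                     C ≢ D → ∃ λ K → ⟦ circuits M ⟧ K × K ⊆ₛ C △ D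
△-contains-circuit {n} M (_ , A , rep) {C} {D} C∈M D∈M C≢D =
  cycle⇒circuit A M rep
    (△-isCycle A {C} {D} (circuit⇒cycle A M rep C∈M) (circuit⇒cycle A M rep D∈M))
    (decidable-stable (any? (_∈? C △ D)) λ empty → C≢D (lookup-injective λ j →
      xor≡false⇒≡ _ _ (trans (sym (lookup-zipWith _xor_ j C D))
        (Boolₚ.¬-not λ eq → empty (j , lookup⇒[]= j (C △ D) eq)))))

-- Pasting

-- Thus `C` is `D₁ ∪ D₂` up to the single common element `e`, whose membership in `C` is left open.
record IsPasting (D₁ D₂ : Subset n) (e : Fin n) (C : Subset n) : Set where
  field
    e∈D₁   : e ∈ₛ D₁
    e∈D₂   : e ∈ₛ D₂
    meet   : ∀ {k} → k ∈ₛ D₁ → k ∈ₛ D₂ → k ≡ e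
    D₁-e⊆C : ∀ {k} → k ∈ₛ D₁ → k ≢ e → k ∈ₛ C
    D₂-e⊆C : ∀ {k} → k ∈ₛ D₂ → k ≢ e → k ∈ₛ C
    C⊆D₁∪D₂ : ∀ {k} → k ∈ₛ C → k ∈ₛ D₁ ⊎ k ∈ₛ D₂

open IsPasting

pasting-sym : ∀ {D₁ D₂ C : Subset n} {e} → IsPasting D₁ D₂ e C → IsPasting D₂ D₁ e C
pasting-sym P = record
  { e∈D₁    = e∈D₂ P
  ; e∈D₂    = e∈D₁ P
  ; meet    = λ k∈D₂ k∈D₁ → meet P k∈D₁ k∈D₂
  ; D₁-e⊆C  = D₂-e⊆C P
  ; D₂-e⊆C  = D₁-e⊆C P
  ; C⊆D₁∪D₂ = swap ∘ C⊆D₁∪D₂ P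
  }

-- Two elements `a`, `b` of `D₂` other than `e` lie in `C` but not in `D₁`, while only `e` can lie
-- in `D₁` and outside `C`; hence ∣ D₁ ∣ ≤ ∣ C ∣ - 2 + 1.
pasting-size : ∀ {D₁ D₂ C : Subset n} {e} → IsPasting D₁ D₂ e C → ∣ D₂ ∣ > 2 → ∣ D₁ ∣ < ∣ C ∣
pasting-size {D₁ = D₁} {D₂} {C} {e} P ∣D₂∣>2
  with a , a∈D₂ , a≢e , _   ← avoid₂ D₂ ∣D₂∣>2 e e
  with b , b∈D₂ , b≢e , b≢a ← avoid₂ D₂ ∣D₂∣>2 e a
  = begin-strict
    ∣ D₁ ∣                      ≤⟨ p⊆q⇒∣p∣≤∣q∣ D₁⊆ ⟩
    ∣ (C - a - b) ∪ ⁅ e ⁆ ∣     ≤⟨ ∣p∪q∣≤∣p∣+∣q∣ (C - a - b) ⁅ e ⁆ ⟩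
    ∣ C - a - b ∣ + ∣ ⁅ e ⁆ ∣   ≡⟨ cong (∣ C - a - b ∣ +_) (∣⁅x⁆∣≡1 e) ⟩
    ∣ C - a - b ∣ + 1           ≡⟨ ℕₚ.+-comm ∣ C - a - b ∣ 1 ⟩
    suc ∣ C - a - b ∣           ≤⟨ x∈p⇒∣p-x∣<∣p∣ (x∈p∧x≢y⇒x∈p-y (D₂-e⊆C P b∈D₂ b≢e) b≢a) ⟩
    ∣ C - a ∣                   <⟨ x∈p⇒∣p-x∣<∣p∣ (D₂-e⊆C P a∈D₂ a≢e) ⟩
    ∣ C ∣                       ∎
  where
  open ℕₚ.≤-Reasoning
  D₁⊆ : D₁ ⊆ₛ (C - a - b) ∪ ⁅ e ⁆
  D₁⊆ {k} k∈D₁ with k ≟ᶠ e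
  ... | yes refl = x∈p∪q⁺ (inj₂ (x∈⁅x⁆ k))
  ... | no k≢e   = x∈p∪q⁺ (inj₁ (x∈p∧x≢y⇒x∈p-y (x∈p∧x≢y⇒x∈p-y (D₁-e⊆C P k∈D₁ k≢e)
                     (λ { refl → k≢e (meet P k∈D₁ a∈D₂) }))
                     (λ { refl → k≢e (meet P k∈D₁ b∈D₂) })))

-- Order on `𝕋` and maxima over a pasting

≰ᴿ⇒≥ᴿ : ∀ x y → ¬ (x ≤ᴿ y) → y ≤ᴿ x
-- Enlarge `q` to `r` still below `y`; locatedness puts `q` below `x` or `r` above `x`, and the
-- latter would give x ≤ y.
≰ᴿ⇒≥ᴿ x y x≰y {q} Lyq with r , q<r , Lyr ← ℝ.L-open y Lyq with ℝ.located x q<r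
... | inj₁ Lxq = Lxq
... | inj₂ Uxr = ⊥-elim (x≰y x≤y)
  where
  x≤y : x ≤ᴿ y
  x≤y {p} Lxp with ℚₚ.<-cmp p r
  ... | tri< p<r _ _  = ℝ.L-down y p<r Lyr
  ... | tri≈ _ refl _ = Lyr
  ... | tri> _ _ r<p  = ⊥-elim (ℝ.disjoint x (ℝ.L-down x r<p Lxp) Uxr)

-- The order of `ℝ` is not decidable; comparability up to double negation suffices because `Vᶜ` is a
-- negation.
≤ᵀ-¬¬total : ∀ s t → ¬ ¬ (s ≤ᵀ t ⊎ t ≤ᵀ s)
≤ᵀ-¬¬total ⊥₋      t       ¬total = ¬total (inj₁ (⊥₋≤ t))
≤ᵀ-¬¬total (fin x) ⊥₋      ¬total = ¬total (inj₂ (⊥₋≤ fin x))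
≤ᵀ-¬¬total (fin x) (fin y) ¬total = ¬total (inj₂ [ ≰ᴿ⇒≥ᴿ x y (λ x≤y → ¬total (inj₁ [ x≤y ])) ])

≤ᵀ-trans : ∀ {s t u} → s ≤ᵀ t → t ≤ᵀ u → s ≤ᵀ u
≤ᵀ-trans = ≤₋-trans λ {x} {y} {z} → ≤ᴿ-trans {x} {y} {z}

AttainedTwice : Subset n → Vector 𝕋 n → Set₁
AttainedTwice C x = ∃₂ λ i j → i ≢ j × AttainsMax C x i × AttainsMax C x j

attained-off : ∀ {C : Subset n} {x} e → AttainedTwice C x → ∃ λ k → k ≢ e × AttainsMax C x k
attained-off e (i , j , i≢j , mi , mj) with i ≟ᶠ e
... | no i≢e   = i , i≢e , mi
... | yes refl = j , i≢j ∘ sym , mj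

module _ {D₁ D₂ C : Subset n} {e} (P : IsPasting D₁ D₂ e C) {x : Vector 𝕋 n} where

  -- Kept in a module of its own so that it also applies to `pasting-sym P`.
  attains-pasting : ∀ {i} → AttainsMax D₁ x i → i ≢ e → (∀ k → k ∈ₛ D₂ → x k ≤ᵀ x i) → AttainsMax C x i
  attains-pasting (i∈D₁ , i-max) i≢e D₂≤i =
    D₁-e⊆C P i∈D₁ i≢e , λ k k∈C → [ i-max k , D₂≤i k ]′ (C⊆D₁∪D₂ P k∈C)

module _ {D₁ D₂ C : Subset n} {e} (P : IsPasting D₁ D₂ e C) {x : Vector 𝕋 n} where

  -- The maxima over D₁ and D₂ are both x e, and each is attained off e.
  attainedTwice-pasting-e : AttainsMax D₁ x e → AttainedTwice D₁ x → AttainedTwice D₂ x →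
                            (∀ k → k ∈ₛ D₂ → x k ≤ᵀ x e) → AttainedTwice C x
  attainedTwice-pasting-e (e∈D₁ , e-max) A₁ A₂ D₂≤e
    with k₁ , k₁≢e , m₁@(k₁∈D₁ , max₁) ← attained-off e A₁
    with k₂ , k₂≢e , m₂@(k₂∈D₂ , max₂) ← attained-off e A₂
    = k₁ , k₂ , (λ { refl → k₁≢e (meet P k₁∈D₁ k₂∈D₂) })
    , attains-pasting P m₁ k₁≢e (λ k k∈D₂ → ≤ᵀ-trans (D₂≤e k k∈D₂) (max₁ e e∈D₁))
    , attains-pasting (pasting-sym P) m₂ k₂≢e
        (λ k k∈D₁ → ≤ᵀ-trans (e-max k k∈D₁) (max₂ e (e∈D₂ P)))

  -- As the maximum over `D₁` dominates `D₂`, both maximizers over `D₁` remain maximizers over `C`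
  -- unless one of them is `e`; then `attainedTwice-pasting-e` applies.
  attainedTwice-pasting-≤ : (A₁ : AttainedTwice D₁ x) → AttainedTwice D₂ x →
                            (∀ k → k ∈ₛ D₂ → x k ≤ᵀ x (proj₁ A₁)) → AttainedTwice C x
  attainedTwice-pasting-≤ A₁@(i , j , i≢j , mi@(i∈D₁ , _) , mj@(_ , j-max)) A₂ D₂≤i
    with i ≟ᶠ e | j ≟ᶠ e
  ... | yes refl | _        = attainedTwice-pasting-e mi A₁ A₂ D₂≤i
  ... | no _     | yes refl = attainedTwice-pasting-e mj A₁ A₂
                                (λ k k∈D₂ → ≤ᵀ-trans (D₂≤i k k∈D₂) (j-max i i∈D₁))
  ... | no i≢e   | no j≢e   = i , j , i≢j , attains-pasting P mi i≢e D₂≤i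
    , attains-pasting P mj j≢e (λ k k∈D₂ → ≤ᵀ-trans (D₂≤i k k∈D₂) (j-max i i∈D₁))

Vᶜ-pasting : ∀ {D₁ D₂ C : Subset n} {e} → IsPasting D₁ D₂ e C → ∀ {x} → Vᶜ D₁ x → Vᶜ D₂ x → Vᶜ C x
Vᶜ-pasting P {x} V₁ V₂ ¬w =
  V₁ λ A₁@(i , _ , _ , (_ , i-max) , _) →
  V₂ λ A₂@(j , _ , _ , (_ , j-max) , _) →
  -- By symmetry of pasting, the circuit with the larger maximum may play the role of `D₁`.
  ≤ᵀ-¬¬total (coord x i) (coord x j) λ
    { (inj₁ xi≤xj) → ¬w (attainedTwice-pasting-≤ (pasting-sym P) A₂ A₁
                       (λ k k∈D₁ → ≤ᵀ-trans (i-max k k∈D₁) xi≤xj))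
    ; (inj₂ xj≤xi) → ¬w (attainedTwice-pasting-≤ P A₁ A₂
                       (λ k k∈D₂ → ≤ᵀ-trans (j-max k k∈D₂) xj≤xi))
    }

-- Chords

-- For a circuit `C`, incomparability forces `e` to lie in `D` and outside `C`.
Chord : Matroid n → Subset n → Subset n → Set
Chord M C D = ⟦ circuits M ⟧ D × D ≢ C × ∃ λ e → D ⊆ₛ C ∪ ⁅ e ⁆

chord? : (M : Matroid n) → ∀ C → Dec (∃ (Chord M C))
chord? M C = anySubset? λ D → T? (circuits M D) ×-dec ¬? (D ≟ₛ C) ×-dec any? (λ e → D ⊆? C ∪ ⁅ e ⁆)

chord⇒pasting : (M : Matroid n) → Simple M → Binary M → ∀ {C} → ⟦ circuits M ⟧ C → ∃ (Chord M C) →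
                ∃ λ D → ∃ λ K → ∃ λ e → ⟦ circuits M ⟧ D × ⟦ circuits M ⟧ K × IsPasting D K e C
chord⇒pasting {n} M simple binary {C} C∈M (D , D∈M , D≢C , e , D⊆C∪e)
  with K , K∈M , K⊆C△D ← △-contains-circuit M binary C∈M D∈M (D≢C ∘ sym)
  = D , K , e , D∈M , K∈M , record
  { e∈D₁    = e∈D
  ; e∈D₂    = e∈K
  ; meet    = D∩K⊆e
  ; D₁-e⊆C  = D-e⊆C
  ; D₂-e⊆C  = K-e⊆C
  ; C⊆D₁∪D₂ = C⊆D∪K
  }
  where
  D-e⊆C : ∀ {k} → k ∈ₛ D → k ≢ e → k ∈ₛ C
  D-e⊆C k∈D = x∈p∪⁅y⁆∧x≢y⇒x∈p C (D⊆C∪e k∈D)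

  K-e⊆C : ∀ {k} → k ∈ₛ K → k ≢ e → k ∈ₛ C
  K-e⊆C k∈K k≢e = [ proj₁ , (λ (_ , k∈D) → D-e⊆C k∈D k≢e) ]′ (x∈p△q⁻ C D (K⊆C△D k∈K))

  D∩K⊆e : ∀ {k} → k ∈ₛ D → k ∈ₛ K → k ≡ e
  -- An element of `D` other than `e` lies in `C` too, hence outside `C △ D`.
  D∩K⊆e {k} k∈D k∈K = decidable-stable (k ≟ᶠ e) λ k≢e →
    [ (λ (_ , k∉D) → k∉D k∈D) , (λ (k∉C , _) → k∉C (D-e⊆C k∈D k≢e)) ]′ (x∈p△q⁻ C D (K⊆C△D k∈K))

  avoids-e : ∀ {J} → ⟦ circuits M ⟧ J → (∀ {k} → k ∈ₛ J → k ≢ e → k ∈ₛ C) → e ∉ₛ J → J ≡ C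
  avoids-e J∈M J-e⊆C e∉J = incomparable M J∈M C∈M λ k∈J → J-e⊆C k∈J λ { refl → e∉J k∈J }

  e∈D : e ∈ₛ D
  e∈D = decidable-stable (e ∈? D) (D≢C ∘ avoids-e D∈M D-e⊆C)

  -- By simplicity `D` has an element besides `e`; in `K` it would be a second common element.
  K⊉D-e : ¬ (∀ {k} → k ∈ₛ D → k ≢ e → k ∈ₛ K)
  K⊉D-e D-e⊆K with a , a∈D , a≢e , _ ← avoid₂ D (simple D D∈M) e e =
    a≢e (D∩K⊆e a∈D (D-e⊆K a∈D a≢e))

  e∈K : e ∈ₛ K
  e∈K = decidable-stable (e ∈? K) λ e∉K →
    -- Without `e`, `K` would equal `C`, which contains `D - e`.
    K⊉D-e λ k∈D k≢e → subst (_ ∈ₛ_) (sym (avoids-e K∈M K-e⊆C e∉K)) (D-e⊆C k∈D k≢e)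

  C⊆D∪K : ∀ {k} → k ∈ₛ C → k ∈ₛ D ⊎ k ∈ₛ K
  C⊆D∪K k∈C
    -- Eliminating `e` from `D` and `K` leaves a circuit `J` inside `C`, hence `C` itself.
    with J , J∈M , J⊆ ← elimination M D∈M K∈M (λ { refl → K⊉D-e λ k∈D _ → k∈D }) e∈D e∈K
    with refl ← incomparable M J∈M C∈M (λ j∈J → let j∈D∪K , j≢e = x∈p-y⁻ (D ∪ K) (J⊆ j∈J) in
                  [ (λ j∈D → D-e⊆C j∈D j≢e) , (λ j∈K → K-e⊆C j∈K j≢e) ]′ (x∈p∪q⁻ D K j∈D∪K))
    = x∈p∪q⁻ D K (proj₁ (x∈p-y⁻ (D ∪ K) (J⊆ k∈C)))

chordless : Matroid n → Family n
chordless M C = circuits M C ∧ ⌊ ¬? (chord? M C) ⌋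

module _ (M : Matroid n) where

  chordless⁺ : ∀ {C} → ⟦ circuits M ⟧ C → ¬ ∃ (Chord M C) → ⟦ chordless M ⟧ C
  chordless⁺ C∈M ¬chord = Equivalence.from Boolₚ.T-∧ (C∈M , fromWitness ¬chord)

  chordless⁻ : ∀ {C} → ⟦ chordless M ⟧ C → ⟦ circuits M ⟧ C × ¬ ∃ (Chord M C)
  chordless⁻ C∈ = let C∈M , w = Equivalence.to Boolₚ.T-∧ C∈ in C∈M , toWitness w

  V-chordless⊆ : Simple M → Binary M → V (chordless M) ⊆ BergmanFan M
  V-chordless⊆ simple binary {x} x∈V C = <-rec
    (λ s → ∀ C → ∣ C ∣ ≡ s → ⟦ circuits M ⟧ C → Vᶜ C x) step ∣ C ∣ C refl
    where
    step : ∀ s → (∀ {t} → t < s → ∀ C → ∣ C ∣ ≡ t → ⟦ circuits M ⟧ C → Vᶜ C x) →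
           ∀ C → ∣ C ∣ ≡ s → ⟦ circuits M ⟧ C → Vᶜ C x
    step s ih C refl C∈M with chord? M C
    ... | no ¬chord = x∈V C (chordless⁺ C∈M ¬chord)
    ... | yes chord with D , K , e , D∈M , K∈M , P ← chord⇒pasting M simple binary C∈M chord =
      Vᶜ-pasting P {x}
        -- Each piece is smaller than `C` because the other, by simplicity, has more than two
        -- elements.
        (ih (pasting-size P (simple K K∈M)) D refl D∈M)
        (ih (pasting-size (pasting-sym P) (simple D D∈M)) K refl K∈M)

  chordless-isTropicalBasis : Simple M → Binary M → IsTropicalBasis M (chordless M)
  chordless-isTropicalBasis simple binary =
    proj₁ ∘ chordless⁻ , (λ {x} → V-chordless⊆ simple binary {x}) , λ x∈V C C∈ → x∈V C (proj₁ (chordless⁻ C∈))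

-- Points separating a chordless circuit from all other circuits

module _ (C : Subset n) (c : Fin n) where

  Finite : Fin n → Set
  Finite i = i ≡ c ⊎ i ∉ₛ C

  finite? : ∀ i → Dec (Finite i)
  finite? i = (i ≟ᶠ c) ⊎-dec ¬? (i ∈? C)

  separatingCoord : Vector 𝕋 n
  separatingCoord i = if ⌊ finite? i ⌋ then fin 0ᴿ else ⊥₋

  coord-finite : ∀ {i} → Finite i → separatingCoord i ≡ fin 0ᴿ
  coord-finite {i} f with finite? i
  ... | yes _ = refl
  ... | no ¬f = contradiction f ¬f

  coord-infinite : ∀ {i} → ¬ Finite i → separatingCoord i ≡ ⊥₋
  coord-infinite {i} ¬f with finite? i
  ... | yes f = contradiction f ¬f
  ... | no _  = refl

  separatingPoint : TP n
  separatingPoint = record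
    { coord   = separatingCoord
    ; nonzero = c , λ eq → case trans (sym (coord-finite (inj₁ refl))) eq of λ ()
    }

  coord-max : ∀ {i} → Finite i → ∀ k → separatingCoord k ≤ᵀ separatingCoord i
  coord-max f k rewrite coord-finite f with finite? k
  ... | yes _ = [ (λ l → l) ]
  ... | no _  = ⊥₋≤ _

  separatingPoint∉V : c ∈ₛ C → ¬ Vᶜ C separatingPoint
  separatingPoint∉V c∈C w = w λ (i , j , i≢j , mi , mj) → i≢j (trans (only-c mi) (sym (only-c mj)))
    where
    only-c : ∀ {i} → AttainsMax C separatingCoord i → i ≡ c
    only-c {i} (i∈C , i-max) = decidable-stable (i ≟ᶠ c) λ i≢c →
      -- The value at `c` is 0, so a maximizer in `C` other than `c` would give 0 ≤ -∞.
      case subst₂ _≤ᵀ_ (coord-finite (inj₁ refl))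
             (coord-infinite {i} [ i≢c , (λ i∉C → i∉C i∈C) ]′) (i-max c c∈C) of λ ()

  separatingPoint∈V : (M : Matroid n) → ⟦ chordless M ⟧ C → ∀ {D} → ⟦ circuits M ⟧ D → D ≢ C →
                      Vᶜ D separatingPoint
  separatingPoint∈V M C∈ {D} D∈M D≢C ¬w
    with C∈M , ¬chord ← chordless⁻ M C∈
    with d₁ , d₁∈D , d₁∉C  ← ⊈⇒∃∉ D C (D≢C ∘ incomparable M D∈M C∈M)
    -- Were `d₁` the only element of `D` outside `C`, `D` would be a chord of `C`.
    with d₂ , d₂∈D , d₂∉ ← ⊈⇒∃∉ D (C ∪ ⁅ d₁ ⁆) (λ D⊆ → ¬chord (D , D∈M , D≢C , d₁ , D⊆))
    = ¬w (d₁ , d₂ , (λ { refl → d₂∉ (x∈p∪q⁺ (inj₂ (x∈⁅x⁆ d₁))) })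
         , (d₁∈D , λ k _ → coord-max (inj₂ d₁∉C) k)
         , (d₂∈D , λ k _ → coord-max (inj₂ (d₂∉ ∘ x∈p∪q⁺ ∘ inj₁)) k))

-- If `B` missed a chordless `C`, the separating point of `C` would lie in `V B`, hence in the
-- Bergman fan, yet outside `Vᶜ C`.
chordless⊆tropicalBasis : (M : Matroid n) → Simple M → ∀ B → IsTropicalBasis M B → ⟦ chordless M ⟧ ⊆ ⟦ B ⟧
chordless⊆tropicalBasis M simple B (B⊆M , VB⊆ , _) {C} C∈ = decidable-stable (T? (B C)) λ C∉B →
  separatingPoint∉V C c c∈C (VB⊆ {separatingPoint C c}
    (λ D D∈B → separatingPoint∈V C c M C∈ (B⊆M D∈B) (λ { refl → C∉B D∈B }))
    C C∈M)
  where
  C∈M : ⟦ circuits M ⟧ C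
  C∈M = proj₁ (chordless⁻ M C∈)
  C-nonempty : Nonempty C
  C-nonempty = decidable-stable (any? (_∈? C)) λ empty →
    ∅∉ M (subst ⟦ circuits M ⟧ (Empty-unique empty) C∈M)
  c = proj₁ C-nonempty
  c∈C = proj₂ C-nonempty

T-ext : ∀ {a b} → (T a → T b) → (T b → T a) → a ≡ b
T-ext f g = Boolₚ.⇔→≡ (mk⇔ (to T-≡ ∘ f ∘ from T-≡) (to T-≡ ∘ g ∘ from T-≡))
  where
  open Equivalence
  open Boolₚ using (T-≡)

theorem4 : (n : ℕ) (M : Matroid n) → Simple M → Binary M → ∃! _≗_ (IsMinimalTropicalBasis M)
theorem4 n M simple binary = chordless M , (basis , minimal) , unique
  where
  basis : IsTropicalBasis M (chordless M)
  basis = chordless-isTropicalBasis M simple binary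

  minimal : ∀ B → ⟦ B ⟧ ⊂ ⟦ chordless M ⟧ → ¬ IsTropicalBasis M B
  minimal B (_ , chordless⊈B) B-basis = chordless⊈B (chordless⊆tropicalBasis M simple B B-basis)

  unique : ∀ {B} → IsMinimalTropicalBasis M B → chordless M ≗ B
  unique {B} (B-basis , B-minimal) C = T-ext chordless⊆B λ C∈B →
    decidable-stable (T? (chordless M C)) λ C∉ →
      -- A member of `B` with a chord would make `chordless M` a proper subset of `B` that is still
      -- a tropical basis.
      B-minimal (chordless M) (chordless⊆B , λ B⊆ → C∉ (B⊆ C∈B)) basis
    where
    chordless⊆B : ⟦ chordless M ⟧ ⊆ ⟦ B ⟧
    chordless⊆B = chordless⊆tropicalBasis M simple B B-basis
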